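{- One has $f(3,4)\ge39$; that is, there exists a family of $39$ distinct $3$-element sets containing no $4$-sunflower.
   Context: $f(w,k)$ denotes the maximum size of a finite family of distinct $w$-element sets (on an arbitrary finite ground set) containing no $k$-sunflower. A $k$-sunflower is a collection of $k$ distinct sets $A_1,\dots,A_k$ for which there is a set $C$ (the core, possibly empty) with $A_i\cap A_j=C$ for all $i\ne j$. -}

module Defs where

open import Data.Fin using (Fin)
open import Data.Fin.Subset using (Subset; _∩_; ∣_∣)
open import Data.List using (List; length)
open import Data.List.Membership.Propositional using (_∈_)
open import Data.List.Relation.Unary.All using (All)
open import Data.List.Relation.Unary.Unique.Propositional using (Unique)
open import Data.Nat using (ℕ; _≤_)
open import Data.Product using (∃; _×_)
open import Function.Definitions using (Injective)
open import Relation.Binary.PropositionalEquality using (_≡_; _≢_)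
open import Relation.Nullary using (¬_)

IsSunflower : ∀ {n} (k : ℕ) → (Fin k → Subset n) → Set
IsSunflower {n} k A =
  Injective _≡_ _≡_ A ×
  ∃ λ (C : Subset n) → ∀ i j → i ≢ j → A i ∩ A j ≡ C

ContainsSunflower : ∀ {n} (k : ℕ) → List (Subset n) → Set
ContainsSunflower {n} k F =
  ∃ λ (A : Fin k → Subset n) → (∀ i → A i ∈ F) × IsSunflower k A

-- A finite family of distinct sets is a list without repetitions, so its size
-- is its length.
record SunflowerFree {n : ℕ} (w k : ℕ) (F : List (Subset n)) : Set where
  field
    distinct    : Unique F
    uniform     : All (λ S → ∣ S ∣ ≡ w) F
    noSunflower : ¬ ContainsSunflower k F

-- The ground set Fin n is arbitrary: n is not fixed.
HasFamilyOfSize : (w k m : ℕ) → Set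
HasFamilyOfSize w k m =
  ∃ λ (n : ℕ) → ∃ λ (F : List (Subset n)) → SunflowerFree w k F × length F ≡ m

-- m = f(w,k).  A relation rather than a function, since for some parameters
-- (e.g. k = 0) the maximum does not exist.
IsMaxSize : (w k m : ℕ) → Set
IsMaxSize w k m =
  HasFamilyOfSize w k m × (∀ m′ → HasFamilyOfSize w k m′ → m′ ≤ m)

{-# OPTIONS --safe #-}

-- The ground set has thirteen points: a centre p, three apexes q₀, q₁, q₂ and
-- three disjoint groups G₀, G₁, G₂ of three points each.  The family consists
-- of the 3 · 4 triples inside some Gᵢ ∪ {p} and the 3 · 9 triples that contain
-- qᵢ and one point of each of the two groups other than Gᵢ.  That it has no
-- 4-sunflower is checked by a pruned exhaustive search: two petals determine
-- the core, and only sets that meet both of them in this core can be the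
-- remaining petals.
module Submission where

import Data.Bool as Bool
open import Data.Empty.Polymorphic using (⊥)
open import Data.Fin using (Fin; zero; suc; combine)
open import Data.Fin.Patterns using (0F; 1F; 2F; 3F)
open import Data.Fin.Properties using (0≢1+n; suc-injective)
open import Data.Fin.Subset using (Subset; _∩_; _∪_; ⁅_⁆; ∣_∣)
open import Data.List using (List; []; _∷_; _++_; concatMap; cartesianProductWith; filter; allFin)
open import Data.List.Membership.Propositional using (_∈_)
open import Data.List.Membership.Propositional.Properties using (∈-filter⁺)
open import Data.List.Relation.Unary.All using (All; all?; lookup)
open import Data.List.Relation.Unary.Unique.DecPropositional using (unique?)
open import Data.Nat as ℕ using (ℕ; zero; suc; _≥_)
open import Data.Product using (_×_; _,_)
open import Data.Vec.Properties using (≡-dec)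
open import Function using (_∘_)
open import Level using (Level)
open import Relation.Binary using (Rel; Decidable; DecidableEquality)
open import Relation.Binary.PropositionalEquality using (_≡_; _≢_; refl; sym; trans)
open import Relation.Nullary using (¬_; Dec; no; ¬?; _×-dec_; from-yes)
open import Defs

private
  variable
    a r : Level

module Clique {A : Set a} {R : Rel A r} (R? : Decidable R) where

  -- Each `x` is tried as the first member of a clique, and the rest is sought only among the
  -- elements it is related to, so a branch ends as soon as no candidate remains. The base case is
  -- `⊥` because the empty clique always exists.
  NoClique : ℕ → List A → Set a
  NoClique zero    xs = ⊥
  NoClique (suc k) xs = All (λ x → NoClique k (filter (R? x) xs)) xs

  noClique? : ∀ k xs → Dec (NoClique k xs)
  noClique? zero    xs = no λ ()
  noClique? (suc k) xs = all? (λ x → noClique? k (filter (R? x) xs)) xs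

  -- Induction on `k`: the values of `f` after the first are all related to `f zero`, hence survive
  -- the filter and form a clique with one member fewer in the filtered list.
  noClique-sound : ∀ k {xs} → NoClique k xs → (f : Fin k → A) →
                   (∀ i → f i ∈ xs) → ¬ (∀ i j → i ≢ j → R (f i) (f j))
  noClique-sound (suc k) none f f∈ clique =
    noClique-sound k (lookup none (f∈ zero)) (f ∘ suc)
      (λ i → ∈-filter⁺ (R? (f zero)) (f∈ (suc i)) (clique zero (suc i) 0≢1+n))
      (λ i j i≢j → clique (suc i) (suc j) (i≢j ∘ suc-injective))

module _ {n : ℕ} where

  infix 4 _≟_

  _≟_ : DecidableEquality (Subset n)
  _≟_ = ≡-dec Bool._≟_

  -- Injectivity is folded into the relation, so that a sunflower with core `C` is exactly a clique.
  Petals : Subset n → Rel (Subset n) _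
  Petals C S T = S ∩ T ≡ C × S ≢ T

  petals? : ∀ C → Decidable (Petals C)
  petals? C S T = (S ∩ T ≟ C) ×-dec ¬? (S ≟ T)

  open module Petals C = Clique (petals? C) using (NoClique; noClique?; noClique-sound)

  petalsOf : Subset n → Subset n → List (Subset n) → List (Subset n)
  petalsOf S T F = filter (petals? (S ∩ T) T) (filter (petals? (S ∩ T) S) F)

  -- Here `k` counts the petals still to be found once `S` and `T` are fixed.
  SearchFails : ℕ → List (Subset n) → Set
  SearchFails k F =
    All (λ S → All (λ T → NoClique (S ∩ T) k (petalsOf S T F)) (filter (¬? ∘ (S ≟_)) F)) F

  searchFails? : ∀ k F → Dec (SearchFails k F)
  searchFails? k F =
    all? (λ S → all? (λ T → noClique? (S ∩ T) k (petalsOf S T F)) (filter (¬? ∘ (S ≟_)) F)) F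

  searchFails-sound : ∀ k {F} → SearchFails k F → ¬ ContainsSunflower (2 ℕ.+ k) F
  searchFails-sound k {F} fails (A , A∈F , A-inj , C , core) =
    noClique-sound (S ∩ T) k
      (lookup (lookup fails (A∈F 0F)) (∈-filter⁺ (¬? ∘ (S ≟_)) (A∈F 1F) (distinct λ ())))
      (λ i → A (suc (suc i)))
      (λ i → ∈-filter⁺ (petals? (S ∩ T) T)
               (∈-filter⁺ (petals? (S ∩ T) S) (A∈F (suc (suc i))) (petals λ ()))
               (petals λ ()))
      (λ i j i≢j → petals (i≢j ∘ suc-injective ∘ suc-injective))
    where
    S T : Subset n
    S = A 0F
    T = A 1F

    distinct : ∀ {i j} → i ≢ j → A i ≢ A j
    distinct i≢j = i≢j ∘ A-inj

    petals : ∀ {i j} → i ≢ j → Petals (S ∩ T) (A i) (A j)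
    -- Both intersections equal the given core `C`, so the computable set `S ∩ T` can replace it.
    petals i≢j = trans (core _ _ i≢j) (sym (core 0F 1F λ ())) , distinct i≢j

triple : Fin 13 → Fin 13 → Fin 13 → Subset 13
triple x y z = ⁅ x ⁆ ∪ ⁅ y ⁆ ∪ ⁅ z ⁆

centre : Fin 13
centre = 0F

apex : Fin 3 → Fin 13
apex 0F = 1F
apex 1F = 2F
apex 2F = 3F

-- The shift by four skips the centre and the apexes; `combine i j` is `3i + j`, so the groups fill
-- the indices 4 to 12.
point : Fin 3 → Fin 3 → Fin 13
point i j = suc (suc (suc (suc (combine i j))))

block : Fin 3 → List (Subset 13)
block i =
  triple (point i 0F) (point i 1F) (point i 2F) ∷
  triple centre (point i 0F) (point i 1F) ∷
  triple centre (point i 0F) (point i 2F) ∷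
  triple centre (point i 1F) (point i 2F) ∷ []

transversals : Fin 3 → Fin 3 → Fin 3 → List (Subset 13)
transversals i j k =
  cartesianProductWith (λ a b → triple (apex i) (point j a) (point k b)) (allFin 3) (allFin 3)

family : List (Subset 13)
family =
  concatMap block (allFin 3) ++
  transversals 0F 1F 2F ++ transversals 1F 0F 2F ++ transversals 2F 0F 1F

family-sunflowerFree : SunflowerFree 3 4 family
family-sunflowerFree = record
  { distinct    = from-yes (unique? _≟_ family)
  ; uniform     = from-yes (all? (λ S → ∣ S ∣ ℕ.≟ 3) family)
  -- The search runs by evaluation during type checking; two of the four petals are `S` and `T`,
  -- which leaves `2`.
  ; noSunflower = searchFails-sound 2 (from-yes (searchFails? 2 family))
  }

hasFamily : HasFamilyOfSize 3 4 39
hasFamily = 13 , family , family-sunflowerFree , refl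

theorem5p1 : (∀ (f : ℕ) → IsMaxSize 3 4 f → f ≥ 39) × HasFamilyOfSize 3 4 39
theorem5p1 = (λ f (_ , max) → max 39 hasFamily) , hasFamily
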